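{- Let $\Gamma$ be a finite set of first-order sentences and let $\Pi$ and $\Pi'$ be modular programs. Then $\Pi$ and $\Pi'$ are strongly equivalent with respect to context $\Gamma$ if and only if every Herbrand interpretation that is a model of $\Gamma$ satisfies $\Phi(\Pi)\leftrightarrow\Phi(\Pi')$.
   Context: $\mathrm{SM}_{\vec{p}}[F]:=F\wedge\neg\exists\vec{U}((\vec{U}<\vec{p})\wedge F^*)$ with fresh predicate variables $\vec{U}$, where $\vec{U}<\vec{p}$ means $\bigwedge_i\forall\vec{x}(U_i(\vec{x})\to p_i(\vec{x}))\wedge\neg\bigwedge_i\forall\vec{x}(p_i(\vec{x})\to U_i(\vec{x}))$, and $F^*$: $F^*=F$ for atomic $F$ without members of $\vec{p}$; $p_i(\vec{t})^*=U_i(\vec{t})$; $(G\otimes H)^*=G^*\otimes H^*$ for $\otimes\in\{\wedge,\vee\}$; $(G\to H)^*=(G^*\to H^*)\wedge(G\to H)$; $(Qx\,G)^*=Qx\,G^*$. A def-module $(\vec{p}:F)$ has $\Phi((\vec{p}:F))=\mathrm{SM}_{\vec{p}}[F]$; a bare formula $F$ used as a module means $(\emptyset:F)$ with $\Phi=F$. A modular program $\Pi=\langle\mathcal{S},\mathcal{M}\rangle$ has public predicates $\mathcal{S}$ and a finite set $\mathcal{M}$ of modules (def-modules or modular programs), with $\Phi(\Pi)=\exists\vec{h}\bigwedge_{M\in\mathcal{M}}\Phi(M)$, $\vec{h}$ the free predicate symbols of the $\Phi(M)$ not in $\mathcal{S}$. An answer set of $\Pi$ is a Herbrand interpretation over $\mathcal{S}$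 satisfying $\Phi(\Pi)$. For modular programs $\Pi,\Pi_1,\Pi_2$, $\Pi[\Pi_1/\Pi_2]$ denotes the result of replacing all occurrences of the module $\Pi_1$ in $\Pi$ by $\Pi_2$, and $\Phi(\Pi-\Pi_1):=\bigwedge\{\Phi(M)\mid M\in\mathcal{M},\ \Pi_1\text{ does not occur in }M\}$ for $\Pi=\langle\mathcal{S},\mathcal{M}\rangle$. Modular programs $\Pi_1,\Pi_2$ are strongly equivalent with respect to context $\Gamma$ if every modular program $\Pi$ with $\Phi(\Pi-\Pi_1)\models\Gamma$ has the same answer sets as $\Pi[\Pi_1/\Pi_2]$.
   Formalization: Strong equivalence tests only programs Π in which no nested program enclosing an occurrence of the replaced module hides a predicate of Γ, before or after replacement; without this naming convention the "if" direction is false, since a hidden predicate can capture one of Γ. -}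

module Defs where

open import Data.Empty using (⊥)
open import Data.Empty.Polymorphic using () renaming (⊥ to ⊥ₗ)
open import Data.Fin using (Fin)
import Data.Fin.Properties as Fin
open import Data.List using (List; []; _∷_; [_]; _++_; map; filter)
import Data.List.Properties as List
open import Data.List.Membership.Propositional using () renaming (_∈_ to _∈ᵐ_)
open import Data.List.Relation.Unary.All using (All; []; _∷_)
open import Data.List.Relation.Unary.Any using (Any; here; there)
open import Data.Nat using (ℕ; zero; suc)
open import Data.Product using (Σ-syntax; _×_; _,_)
open import Data.Sum using (_⊎_; inj₁; inj₂)
open import Data.Vec using (Vec; []; _∷_; lookup; allFin)
  renaming (map to mapᵥ)
open import Function.Bundles using (_⇔_)
open import Level using (Lift; 0ℓ) renaming (suc to lsuc)
open import Relation.Binary.Definitions using (DecidableEquality)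
open import Relation.Binary.PropositionalEquality using (_≡_; refl; cong)
open import Relation.Nullary using (¬_; Dec; yes; no; ¬?)
open import Relation.Nullary.Decidable using (map′; _×-dec_; _⊎-dec_)

record Signature : Set₁ where
  field
    Fn       : Set
    fnArity  : Fn → ℕ
    _≟ᶠ_     : DecidableEquality Fn
    Pd       : Set
    pdArity  : Pd → ℕ
    _≟ᵖ_     : DecidableEquality Pd
    -- An object constant, so that the Herbrand universe is inhabited (and,
    -- with it, the domain of every interpretation).
    constant : Σ[ c ∈ Fn ] fnArity c ≡ 0

data Connective : Set where
  and or imp : Connective

data Quantifier : Set where
  univ exis : Quantifier

module Language (σ : Signature) where
  open Signature σ

  -- n is the number of free object variables (de Bruijn).
  data Term (n : ℕ) : Set where
    var : Fin n → Term n
    fn  : (f : Fn) → Vec (Term n) (fnArity f) → Term n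

  data Atom (R : Set) (arity : R → ℕ) (n : ℕ) : Set where
    false : Atom R arity n
    _≐_   : Term n → Term n → Atom R arity n
    rel   : (r : R) → Vec (Term n) (arity r) → Atom R arity n

  data Formula (n : ℕ) : Set where
    atom  : Atom Pd pdArity n → Formula n
    bin   : Connective → Formula n → Formula n → Formula n
    quant : Quantifier → Formula (suc n) → Formula n

  Sentence : Set
  Sentence = Formula 0

  -- Besides the predicate symbols there is one predicate variable for each of
  -- them.  Modules are written with predicate symbols only, so `pvar p` is
  -- always fresh: it plays the part of the Uᵢ that goes with pᵢ in SM.
  data Sym : Set where
    psym pvar : Pd → Sym

  symArity : Sym → ℕ
  symArity (psym p) = pdArity p
  symArity (pvar p) = pdArity p

  _≟ˢ_ : DecidableEquality Sym
  psym p ≟ˢ psym q = map′ (cong psym) (λ { refl → refl }) (p ≟ᵖ q)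
  psym p ≟ˢ pvar q = no λ ()
  pvar p ≟ˢ psym q = no λ ()
  pvar p ≟ˢ pvar q = map′ (cong pvar) (λ { refl → refl }) (p ≟ᵖ q)

  open import Data.List.Membership.DecPropositional _≟ˢ_ using (_∈_; _∉_; _∈?_) public
  open import Data.List.Membership.DecPropositional _≟ᵖ_ using ()
    renaming (_∈_ to _∈ᵖ_; _∉_ to _∉ᵖ_; _∈?_ to _∈ᵖ?_) public
  open import Data.List.Relation.Binary.Subset.DecPropositional _≟ᵖ_ using (_⊆_; _⊆?_) public

  data SOFormula (n : ℕ) : Set where
    atom  : Atom Sym symArity n → SOFormula n
    bin   : Connective → SOFormula n → SOFormula n → SOFormula n
    quant : Quantifier → SOFormula (suc n) → SOFormula n
    -- ∃ h₁ … hₖ; the bound symbols may be predicate symbols.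
    ∃²    : List Sym → SOFormula n → SOFormula n

  infixr 6 _∧'_
  infixr 5 _⊃_
  infix  4 _⇿_

  ⊥' ⊤' : ∀ {n} → SOFormula n
  ⊥' = atom false
  ⊤' = bin imp ⊥' ⊥'

  _∧'_ _⊃_ _⇿_ : ∀ {n} → SOFormula n → SOFormula n → SOFormula n
  φ ∧' ψ = bin and φ ψ
  φ ⊃ ψ  = bin imp φ ψ
  φ ⇿ ψ  = (φ ⊃ ψ) ∧' (ψ ⊃ φ)

  ¬' : ∀ {n} → SOFormula n → SOFormula n
  ¬' φ = φ ⊃ ⊥'

  ⋀ : ∀ {n} → List (SOFormula n) → SOFormula n
  ⋀ []       = ⊤'
  ⋀ (φ ∷ φs) = φ ∧' ⋀ φs

  ∀* : ∀ {n} → SOFormula n → SOFormula 0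
  ∀* {zero}  φ = φ
  ∀* {suc n} φ = ∀* (quant univ φ)

  free : ∀ {n} → SOFormula n → List Sym
  free (atom false)     = []
  free (atom (t ≐ u))   = []
  free (atom (rel s _)) = [ s ]
  free (bin _ φ ψ)      = free φ ++ free ψ
  free (quant _ φ)      = free φ
  free (∃² h φ)         = filter (λ s → ¬? (s ∈? h)) (free φ)

  embed : ∀ {n} → Formula n → SOFormula n
  embed (atom false)      = atom false
  embed (atom (t ≐ u))    = atom (t ≐ u)
  embed (atom (rel p ts)) = atom (rel (psym p) ts)
  embed (bin c F G)       = bin c (embed F) (embed G)
  embed (quant q F)       = quant q (embed F)

  star : ∀ {n} → List Pd → Formula n → SOFormula n
  star ps (atom false)      = atom false
  star ps (atom (t ≐ u))    = atom (t ≐ u)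
  star ps (atom (rel p ts)) with p ∈ᵖ? ps
  ... | yes _ = atom (rel (pvar p) ts)
  ... | no  _ = atom (rel (psym p) ts)
  star ps (bin and F G)     = bin and (star ps F) (star ps G)
  star ps (bin or F G)      = bin or (star ps F) (star ps G)
  star ps (bin imp F G)     = (star ps F ⊃ star ps G) ∧' (embed F ⊃ embed G)
  star ps (quant q F)       = quant q (star ps F)

  pvar⊆psym psym⊆pvar : Pd → SOFormula 0
  pvar⊆psym p = ∀* (atom (rel (pvar p) xs) ⊃ atom (rel (psym p) xs))
    where xs = mapᵥ var (allFin (pdArity p))
  psym⊆pvar p = ∀* (atom (rel (psym p) xs) ⊃ atom (rel (pvar p) xs))
    where xs = mapᵥ var (allFin (pdArity p))

  U<_ : List Pd → SOFormula 0
  U< ps = ⋀ (map pvar⊆psym ps) ∧' ¬' (⋀ (map psym⊆pvar ps))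

  SM : List Pd → Sentence → SOFormula 0
  SM ps F = embed F ∧' ¬' (∃² (map pvar ps) ((U< ps) ∧' star ps F))

  -- Sets of predicate symbols and of modules are listed; _≈_ below is equality
  -- of modules as nested finite sets.
  data Program : Set
  data Module  : Set

  data Program where
    ⟨_,_⟩ : List Pd → List Module → Program

  data Module where
    def  : List Pd → Sentence → Module
    prog : Program → Module

  -- SM [] F is F ∧ ¬(⊤ ∧ ¬⊤ ∧ F*), equivalent to F.
  formula : Sentence → Module
  formula F = def [] F

  modules : Program → List Module
  modules ⟨ S , ℳ ⟩ = ℳ

  mutual
    Φ : Program → SOFormula 0
    Φ ⟨ S , ℳ ⟩ = ∃² (hidden ⟨ S , ℳ ⟩) (⋀ (Φs ℳ))

    hidden : Program → List Sym
    hidden ⟨ S , ℳ ⟩ = filter (λ s → ¬? (s ∈? map psym S)) (free (⋀ (Φs ℳ)))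

    Φᵐ : Module → SOFormula 0
    Φᵐ (def ps F) = SM ps F
    Φᵐ (prog Π)   = Φ Π

    Φs : List Module → List (SOFormula 0)
    Φs []      = []
    Φs (M ∷ ℳ) = Φᵐ M ∷ Φs ℳ

  infix 4 _≋_ _≋?_ _≈_ _≈?_

  _≋_ : List Pd → List Pd → Set
  S ≋ T = S ⊆ T × T ⊆ S

  _≋?_ : ∀ S T → Dec (S ≋ T)
  S ≋? T = (S ⊆? T) ×-dec (T ⊆? S)

  data _≈_ : Module → Module → Set where
    def  : ∀ {ps F} → def ps F ≈ def ps F
    prog : ∀ {S T ℳ 𝒩} → S ≋ T →
           All (λ M → Any (λ N → M ≈ N) 𝒩) ℳ →
           All (λ N → Any (λ M → M ≈ N) ℳ) 𝒩 →
           prog ⟨ S , ℳ ⟩ ≈ prog ⟨ T , 𝒩 ⟩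

  mutual
    _≟ᵗ_ : ∀ {n} → DecidableEquality (Term n)
    var x   ≟ᵗ var y   = map′ (cong var) (λ { refl → refl }) (x Fin.≟ y)
    var x   ≟ᵗ fn g us = no λ ()
    fn f ts ≟ᵗ var y   = no λ ()
    fn f ts ≟ᵗ fn g us with f ≟ᶠ g
    ... | no f≢g   = no λ { refl → f≢g refl }
    ... | yes refl with ts ≟ᵗˢ us
    ...   | yes refl = yes refl
    ...   | no ts≢us = no λ { refl → ts≢us refl }

    _≟ᵗˢ_ : ∀ {n k} → DecidableEquality (Vec (Term n) k)
    []       ≟ᵗˢ []       = yes refl
    (t ∷ ts) ≟ᵗˢ (u ∷ us) =
      map′ (λ { (refl , refl) → refl }) (λ { refl → refl , refl })
           ((t ≟ᵗ u) ×-dec (ts ≟ᵗˢ us))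

  _≟ᵃ_ : ∀ {n} → DecidableEquality (Atom Pd pdArity n)
  false    ≟ᵃ false      = yes refl
  false    ≟ᵃ (_ ≐ _)    = no λ ()
  false    ≟ᵃ rel _ _    = no λ ()
  (_ ≐ _)  ≟ᵃ false      = no λ ()
  (t ≐ u)  ≟ᵃ (t′ ≐ u′)  =
    map′ (λ { (refl , refl) → refl }) (λ { refl → refl , refl })
         ((t ≟ᵗ t′) ×-dec (u ≟ᵗ u′))
  (_ ≐ _)  ≟ᵃ rel _ _    = no λ ()
  rel _ _  ≟ᵃ false      = no λ ()
  rel _ _  ≟ᵃ (_ ≐ _)    = no λ ()
  rel p ts ≟ᵃ rel q us with p ≟ᵖ q
  ... | no p≢q   = no λ { refl → p≢q refl }
  ... | yes refl with ts ≟ᵗˢ us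
  ...   | yes refl = yes refl
  ...   | no ts≢us = no λ { refl → ts≢us refl }

  _≟ᶜ_ : DecidableEquality Connective
  and ≟ᶜ and = yes refl
  and ≟ᶜ or  = no λ ()
  and ≟ᶜ imp = no λ ()
  or  ≟ᶜ and = no λ ()
  or  ≟ᶜ or  = yes refl
  or  ≟ᶜ imp = no λ ()
  imp ≟ᶜ and = no λ ()
  imp ≟ᶜ or  = no λ ()
  imp ≟ᶜ imp = yes refl

  _≟ᵠ_ : DecidableEquality Quantifier
  univ ≟ᵠ univ = yes refl
  univ ≟ᵠ exis = no λ ()
  exis ≟ᵠ univ = no λ ()
  exis ≟ᵠ exis = yes refl

  _≟ᶠᵐ_ : ∀ {n} → DecidableEquality (Formula n)
  atom a    ≟ᶠᵐ atom b       = map′ (cong atom) (λ { refl → refl }) (a ≟ᵃ b)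
  atom _    ≟ᶠᵐ bin _ _ _    = no λ ()
  atom _    ≟ᶠᵐ quant _ _    = no λ ()
  bin _ _ _ ≟ᶠᵐ atom _       = no λ ()
  bin c F G ≟ᶠᵐ bin d F′ G′  =
    map′ (λ { (refl , refl , refl) → refl }) (λ { refl → refl , refl , refl })
         ((c ≟ᶜ d) ×-dec (F ≟ᶠᵐ F′) ×-dec (G ≟ᶠᵐ G′))
  bin _ _ _ ≟ᶠᵐ quant _ _    = no λ ()
  quant _ _ ≟ᶠᵐ atom _       = no λ ()
  quant _ _ ≟ᶠᵐ bin _ _ _    = no λ ()
  quant q F ≟ᶠᵐ quant r G    =
    map′ (λ { (refl , refl) → refl }) (λ { refl → refl , refl })
         ((q ≟ᵠ r) ×-dec (F ≟ᶠᵐ G))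

  mutual
    _≈?_ : ∀ M N → Dec (M ≈ N)
    def ps F ≈? def qs G =
      map′ (λ { (refl , refl) → def }) (λ { def → refl , refl })
           (List.≡-dec _≟ᵖ_ ps qs ×-dec (F ≟ᶠᵐ G))
    def _ _  ≈? prog _   = no λ ()
    prog _   ≈? def _ _  = no λ ()
    prog ⟨ S , ℳ ⟩ ≈? prog ⟨ T , 𝒩 ⟩ =
      map′ (λ { (a , b , c) → prog a b c })
           (λ { (prog a b c) → a , b , c })
           ((S ≋? T) ×-dec left? ℳ 𝒩 ×-dec right? ℳ 𝒩)

    left? : ∀ ℳ 𝒩 → Dec (All (λ M → Any (λ N → M ≈ N) 𝒩) ℳ)
    left? []      𝒩 = yes []
    left? (M ∷ ℳ) 𝒩 = map′ (λ { (p , ps) → p ∷ ps }) (λ { (p ∷ ps) → p , ps })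
                           (anyʳ? M 𝒩 ×-dec left? ℳ 𝒩)

    right? : ∀ ℳ 𝒩 → Dec (All (λ N → Any (λ M → M ≈ N) ℳ) 𝒩)
    right? ℳ []      = yes []
    right? ℳ (N ∷ 𝒩) = map′ (λ { (p , ps) → p ∷ ps }) (λ { (p ∷ ps) → p , ps })
                            (anyˡ? ℳ N ×-dec right? ℳ 𝒩)

    anyʳ? : ∀ M 𝒩 → Dec (Any (λ N → M ≈ N) 𝒩)
    anyʳ? M []      = no λ ()
    anyʳ? M (N ∷ 𝒩) = map′ (λ { (inj₁ p) → here p ; (inj₂ p) → there p })
                           (λ { (here p) → inj₁ p ; (there p) → inj₂ p })
                           ((M ≈? N) ⊎-dec anyʳ? M 𝒩)

    anyˡ? : ∀ ℳ N → Dec (Any (λ M → M ≈ N) ℳ)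
    anyˡ? []      N = no λ ()
    anyˡ? (M ∷ ℳ) N = map′ (λ { (inj₁ p) → here p ; (inj₂ p) → there p })
                           (λ { (here p) → inj₁ p ; (there p) → inj₂ p })
                           ((M ≈? N) ⊎-dec anyˡ? ℳ N)

  infix 4 _occursIn_ _⊏_

  data _occursIn_ (Π : Program) : Module → Set where
    here  : ∀ {M} → M ≈ prog Π → Π occursIn M
    there : ∀ {S ℳ} → Any (Π occursIn_) ℳ → Π occursIn prog ⟨ S , ℳ ⟩

  mutual
    occurs? : ∀ Π M → Dec (Π occursIn M)
    occurs? Π (def ps F)       = no λ { (here ()) }
    occurs? Π (prog ⟨ S , ℳ ⟩) =
      map′ (λ { (inj₁ p) → here p ; (inj₂ p) → there p })
           (λ { (here p) → inj₁ p ; (there p) → inj₂ p })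
           ((prog ⟨ S , ℳ ⟩ ≈? prog Π) ⊎-dec occursAny? Π ℳ)

    occursAny? : ∀ Π ℳ → Dec (Any (Π occursIn_) ℳ)
    occursAny? Π []      = no λ ()
    occursAny? Π (M ∷ ℳ) =
      map′ (λ { (inj₁ p) → here p ; (inj₂ p) → there p })
           (λ { (here p) → inj₁ p ; (there p) → inj₂ p })
           (occurs? Π M ⊎-dec occursAny? Π ℳ)

  mutual
    infix 30 _[_/_]

    -- The occurrences replaced are those among the modules of the program, at
    -- any depth; the outermost program itself is not one of its modules.
    _[_/_] : Program → Program → Program → Program
    ⟨ S , ℳ ⟩ [ Π₁ / Π₂ ] = ⟨ S , replaceAll Π₁ Π₂ ℳ ⟩

    replace : Program → Program → Module → Module
    replace Π₁ Π₂ (def ps F) = def ps F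
    replace Π₁ Π₂ (prog Π) with prog Π ≈? prog Π₁
    ... | yes _ = prog Π₂
    ... | no  _ = prog (Π [ Π₁ / Π₂ ])

    replaceAll : Program → Program → List Module → List Module
    replaceAll Π₁ Π₂ []      = []
    replaceAll Π₁ Π₂ (M ∷ ℳ) = replace Π₁ Π₂ M ∷ replaceAll Π₁ Π₂ ℳ

  Φ[_-_] : Program → Program → SOFormula 0
  Φ[ Π - Π₁ ] = ⋀ (map Φᵐ (filter (λ M → ¬? (occurs? Π₁ M)) (modules Π)))

  data _⊏_ (Π : Program) : Program → Set where
    here  : ∀ {S ℳ} → prog Π ∈ᵐ ℳ → Π ⊏ ⟨ S , ℳ ⟩
    there : ∀ {S ℳ Π′} → prog Π′ ∈ᵐ ℳ → Π ⊏ Π′ → Π ⊏ ⟨ S , ℳ ⟩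

  record Interpretation : Set₁ where
    field
      Dom  : Set
      fun  : (f : Fn) → Vec Dom (fnArity f) → Dom
      pred : (p : Pd) → Vec Dom (pdArity p) → Set

  -- Truth values are types; under excluded middle this is classical satisfaction.
  module Satisfaction (Dom : Set) (fun : (f : Fn) → Vec Dom (fnArity f) → Dom) where

    Valuation : Set₁
    Valuation = (s : Sym) → Vec Dom (symArity s) → Set

    mutual
      eval : ∀ {n} → Vec Dom n → Term n → Dom
      eval e (var x)   = lookup e x
      eval e (fn f ts) = fun f (evals e ts)

      evals : ∀ {n k} → Vec Dom n → Vec (Term n) k → Vec Dom k
      evals e []       = []
      evals e (t ∷ ts) = eval e t ∷ evals e ts

    Sat : ∀ {n} → Valuation → Vec Dom n → SOFormula n → Set₁
    Sat V e (atom false)      = ⊥ₗ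
    Sat V e (atom (t ≐ u))    = Lift (lsuc 0ℓ) (eval e t ≡ eval e u)
    Sat V e (atom (rel s ts)) = Lift (lsuc 0ℓ) (V s (evals e ts))
    Sat V e (bin and φ ψ)     = Sat V e φ × Sat V e ψ
    Sat V e (bin or φ ψ)      = Sat V e φ ⊎ Sat V e ψ
    Sat V e (bin imp φ ψ)     = Sat V e φ → Sat V e ψ
    Sat V e (quant univ φ)    = (d : Dom) → Sat V (d ∷ e) φ
    Sat V e (quant exis φ)    = Σ[ d ∈ Dom ] Sat V (d ∷ e) φ
    Sat V e (∃² h φ)          =
      Σ[ W ∈ Valuation ] (∀ s → s ∉ h → W s ≡ V s) × Sat W e φ

  infix 4 _⊨_ _⊫_

  -- No predicate variable is free in Φ(Π) or in a first-order formula, so the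
  -- value given to predicate variables is immaterial there.
  _⊨_ : Interpretation → SOFormula 0 → Set₁
  I ⊨ φ = Sat V [] φ
    where
    open Interpretation I
    open Satisfaction Dom fun
    V : Valuation
    V (psym p) = pred p
    V (pvar p) = λ _ → ⊥

  _⊫_ : SOFormula 0 → SOFormula 0 → Set₁
  φ ⊫ ψ = (I : Interpretation) → I ⊨ φ → I ⊨ ψ

  -- Herbrand interpretations, as sets of ground atoms.
  Herbrand : Set₁
  Herbrand = (p : Pd) → Vec (Term 0) (pdArity p) → Set

  herbrand : Herbrand → Interpretation
  herbrand H = record { Dom = Term 0 ; fun = fn ; pred = H }

  Over : List Pd → Herbrand → Set
  Over S H = ∀ p → p ∉ᵖ S → ∀ ts → ¬ H p ts

  AnswerSet : Program → Herbrand → Set₁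
  AnswerSet ⟨ S , ℳ ⟩ H = Over S H × (herbrand H ⊨ Φ ⟨ S , ℳ ⟩)

  Theory : List Sentence → SOFormula 0
  Theory Γ = ⋀ (map embed Γ)

  -- Bound predicate symbols are kept apart from the predicate symbols of the
  -- context: no program nested in Π that encloses a replaced occurrence of Π₁
  -- binds a predicate symbol of Γ, before or after the replacement.  Without
  -- this convention Γ and the occurrence of Π₁ would speak of different
  -- predicates with the same name.  For instance, with Γ = {p}, Π₁ = q ↔ p and
  -- Π₂ = q, the program ⟨{p,q}, {p, ⟨{q}, {Π₁}⟩}⟩ amounts to p ∧ ∃p (q ↔ p), but
  -- after replacement to p ∧ q, although q ↔ p and q are equivalent under Γ.
  -- Occurrences of Π₁ directly among the modules of Π are unrestricted.
  NoCapture : List Sentence → Program → Program → Program → Set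
  NoCapture Γ Π₁ Π₂ Π =
    ∀ Π′ → Π′ ⊏ Π → Any (Π₁ occursIn_) (modules Π′) →
    ∀ s → s ∈ free (Theory Γ) → s ∉ hidden Π′ × s ∉ hidden (Π′ [ Π₁ / Π₂ ])

  StronglyEquivalent : List Sentence → Program → Program → Set₁
  StronglyEquivalent Γ Π₁ Π₂ =
    (Π : Program) → NoCapture Γ Π₁ Π₂ Π → Φ[ Π - Π₁ ] ⊫ Theory Γ →
    (H : Herbrand) → AnswerSet Π H ⇔ AnswerSet (Π [ Π₁ / Π₂ ]) H

{-# OPTIONS --safe #-}
-- For the "only if" direction, test strong equivalence on the program whose
-- modules are Π₁ and the sentences of Γ, with every predicate symbol that
-- matters public.  Its answer sets are the Herbrand models of Γ ∧ Φ(Π₁), up to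
-- emptying the irrelevant predicates.  Π₁ cannot occur strictly inside itself,
-- its nesting depth being finite, so the no-capture proviso holds vacuously.
--
-- For the "if" direction, the modules of Π in which Π₁ does not occur survive
-- the replacement, so both before and after it they force Γ on every choice of
-- values for the hidden symbols.  Since no program around a nested occurrence
-- rebinds a symbol of Γ, Γ still holds at each occurrence of Π₁, where the
-- hypothesis exchanges Φ(Π₁) for Φ(Π₂).

module Submission where

open import Defs
open import Data.Empty using (⊥; ⊥-elim)
open import Data.List using (List; []; _∷_; _++_; map; filter)
open import Data.List.Membership.Propositional using (lose) renaming (_∈_ to _∈ᵐ_)
open import Data.List.Membership.Propositional.Properties
  using (∈-filter⁺; ∈-filter⁻; ∈-++⁺ˡ; ∈-++⁺ʳ; ∈-++⁻; ∈-map⁺; ∈-map⁻)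
open import Data.List.Relation.Unary.All as All using (All; []; _∷_)
open import Data.List.Relation.Unary.Any using (Any; here; there)
open import Data.Nat using (ℕ; zero; suc; _⊔_; _≤_; _<_; z≤n; s≤s)
open import Data.Nat.Properties
  using (≤-trans; <-trans; <-irrefl; n≤1+n; m≤m⊔n; m≤n⊔m; ⊔-lub)
open import Data.Product using (_×_; _,_; proj₁; proj₂; swap)
open import Data.Sum using (inj₁; inj₂)
open import Data.Vec using (Vec; []; allFin) renaming (map to mapᵥ)
open import Function using (_∘_; id)
open import Function.Bundles using (_⇔_; mk⇔; module Equivalence)
open import Level using (lift; lower)
open import Relation.Binary.PropositionalEquality using (_≡_; refl; sym; trans; cong; cong₂; subst)
open import Relation.Nullary using (¬_; yes; no; ¬?)
open import Relation.Nullary.Decidable using (decidable-stable)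
open Equivalence using (to; from)

module _ {σ : Signature} where
  open Signature σ
  open Language σ

  -- Free symbols

  -- Truth of such a formula depends only on the predicate symbols, so `⊨` and `Sat` can be compared
  -- on it.
  PvarFree : ∀ {n} → SOFormula n → Set
  PvarFree φ = ∀ {p} → pvar p ∉ free φ

  pvarFree-bin : ∀ {n} c {φ ψ : SOFormula n} → PvarFree φ → PvarFree ψ → PvarFree (bin c φ ψ)
  pvarFree-bin c {φ} ∉φ ∉ψ s∈ with ∈-++⁻ (free φ) s∈
  ... | inj₁ s∈φ = ∉φ s∈φ
  ... | inj₂ s∈ψ = ∉ψ s∈ψ

  pvarFree-⋀ : ∀ {A : Set} {n} {f : A → SOFormula n} → (∀ x → PvarFree (f x)) →
               ∀ xs → PvarFree (⋀ (map f xs))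
  pvarFree-⋀ ∉f []       = λ ()
  pvarFree-⋀ {f = f} ∉f (x ∷ xs) =
    pvarFree-bin and {f x} {⋀ (map f xs)} (∉f x) (pvarFree-⋀ ∉f xs)

  pvarFree-embed : ∀ {n} (F : Formula n) → PvarFree (embed F)
  pvarFree-embed (atom false)      ()
  pvarFree-embed (atom (_ ≐ _))    ()
  pvarFree-embed (atom (rel _ _))  (here ())
  pvarFree-embed (atom (rel _ _))  (there ())
  pvarFree-embed (bin c F G)       =
    pvarFree-bin c {embed F} {embed G} (pvarFree-embed F) (pvarFree-embed G)
  pvarFree-embed (quant _ F)       = pvarFree-embed F

  -- `star` brings in a predicate variable only at an atom over `ps`; the unstarred copy of an
  -- implication brings in none.
  pvar∈star : ∀ {n p} ps (F : Formula n) → pvar p ∈ free (star ps F) → p ∈ᵖ ps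
  pvar∈star ps (atom (rel q _)) s∈ with q ∈ᵖ? ps
  pvar∈star ps (atom (rel q _)) (here refl) | yes q∈ps = q∈ps
  pvar∈star ps (atom (rel q _)) (here ())   | no _
  pvar∈star ps (bin and F G) s∈ with ∈-++⁻ (free (star ps F)) s∈
  ... | inj₁ s∈F = pvar∈star ps F s∈F
  ... | inj₂ s∈G = pvar∈star ps G s∈G
  pvar∈star ps (bin or F G) s∈ with ∈-++⁻ (free (star ps F)) s∈
  ... | inj₁ s∈F = pvar∈star ps F s∈F
  ... | inj₂ s∈G = pvar∈star ps G s∈G
  pvar∈star ps (bin imp F G) s∈ with ∈-++⁻ (free (star ps F) ++ free (star ps G)) s∈
  ... | inj₂ s∈F⊃G =
    ⊥-elim (pvarFree-bin imp {embed F} {embed G} (pvarFree-embed F) (pvarFree-embed G) s∈F⊃G)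
  ... | inj₁ s∈* with ∈-++⁻ (free (star ps F)) s∈*
  ...   | inj₁ s∈F = pvar∈star ps F s∈F
  ...   | inj₂ s∈G = pvar∈star ps G s∈G
  pvar∈star ps (quant _ F) s∈ = pvar∈star ps F s∈

  free-∀* : ∀ {n} (φ : SOFormula n) → free (∀* φ) ≡ free φ
  free-∀* {zero}  φ = refl
  free-∀* {suc n} φ = free-∀* (quant univ φ)

  vars : ∀ p → Vec (Term (pdArity p)) (pdArity p)
  vars p = mapᵥ var (allFin (pdArity p))

  pvar∈pvar⊆psym : ∀ {p} q → pvar p ∈ free (pvar⊆psym q) → p ≡ q
  pvar∈pvar⊆psym {p} q s∈
    with subst (pvar p ∈_) (free-∀* (atom (rel (pvar q) (vars q)) ⊃ atom (rel (psym q) (vars q)))) s∈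
  ... | here refl = refl
  ... | there (here ())

  pvar∈psym⊆pvar : ∀ {p} q → pvar p ∈ free (psym⊆pvar q) → p ≡ q
  pvar∈psym⊆pvar {p} q s∈
    with subst (pvar p ∈_) (free-∀* (atom (rel (psym q) (vars q)) ⊃ atom (rel (pvar q) (vars q)))) s∈
  ... | here ()
  ... | there (here refl) = refl

  pvar∈⋀ : ∀ {n p} {f : Pd → SOFormula n} → (∀ q → pvar p ∈ free (f q) → p ≡ q) →
           ∀ ps → pvar p ∈ free (⋀ (map f ps)) → p ∈ᵖ ps
  pvar∈⋀ {f = f} own (q ∷ ps) s∈ with ∈-++⁻ (free (f q)) s∈
  ... | inj₁ s∈q = here (own q s∈q)
  ... | inj₂ s∈ps = there (pvar∈⋀ own ps s∈ps)

  pvar∈U< : ∀ {p} ps → pvar p ∈ free (U< ps) → p ∈ᵖ ps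
  pvar∈U< ps s∈ with ∈-++⁻ (free (⋀ (map pvar⊆psym ps))) s∈
  ... | inj₁ s∈⊆ = pvar∈⋀ pvar∈pvar⊆psym ps s∈⊆
  ... | inj₂ s∈¬ with ∈-++⁻ (free (⋀ (map psym⊆pvar ps))) s∈¬
  ...   | inj₁ s∈⊇ = pvar∈⋀ pvar∈psym⊆pvar ps s∈⊇

  -- The quantifier in `SM` ranges over `map pvar ps`, which covers every predicate variable of `U<`
  -- and `star`.
  pvarFree-SM : ∀ ps F → PvarFree (SM ps F)
  pvarFree-SM ps F s∈ with ∈-++⁻ (free (embed F)) s∈
  ... | inj₁ s∈F = pvarFree-embed F s∈F
  ... | inj₂ s∈¬ with ∈-++⁻ (free (∃² (map pvar ps) ((U< ps) ∧' star ps F))) s∈¬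
  ...   | inj₁ s∈∃ with ∈-filter⁻ (λ s → ¬? (s ∈? map pvar ps)) {xs = free ((U< ps) ∧' star ps F)} s∈∃
  ...     | s∈body , s∉ps with ∈-++⁻ (free (U< ps)) s∈body
  ...       | inj₁ s∈U = s∉ps (∈-map⁺ pvar (pvar∈U< ps s∈U))
  ...       | inj₂ s∈* = s∉ps (∈-map⁺ pvar (pvar∈star ps F s∈*))

  hidden⁺ : ∀ {s} S ℳ → s ∈ free (⋀ (Φs ℳ)) → s ∉ map psym S → s ∈ hidden ⟨ S , ℳ ⟩
  hidden⁺ S ℳ = ∈-filter⁺ (λ s → ¬? (s ∈? map psym S))

  hidden⁻ : ∀ {s} S ℳ → s ∈ hidden ⟨ S , ℳ ⟩ → s ∉ map psym S
  hidden⁻ S ℳ s∈ = proj₂ (∈-filter⁻ (λ s → ¬? (s ∈? map psym S)) {xs = free (⋀ (Φs ℳ))} s∈)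

  ∉hidden⇒public : ∀ {s} S ℳ → s ∈ free (⋀ (Φs ℳ)) → s ∉ hidden ⟨ S , ℳ ⟩ → s ∈ map psym S
  ∉hidden⇒public {s} S ℳ s∈ s∉h =
    decidable-stable (s ∈? map psym S) (s∉h ∘ hidden⁺ S ℳ s∈)

  -- Each free symbol of the conjunction is public or hidden, and `Φ` binds the hidden ones.
  free-Φ⊆public : ∀ {s} S ℳ → s ∈ free (Φ ⟨ S , ℳ ⟩) → s ∈ map psym S
  free-Φ⊆public S ℳ s∈
    with ∈-filter⁻ (λ s → ¬? (s ∈? hidden ⟨ S , ℳ ⟩)) {xs = free (⋀ (Φs ℳ))} s∈
  ... | s∈ℳ , s∉h = ∉hidden⇒public S ℳ s∈ℳ s∉h

  pvarFree-Φ : ∀ Π → PvarFree (Φ Π)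
  pvarFree-Φ ⟨ S , ℳ ⟩ s∈ with ∈-map⁻ psym (free-Φ⊆public S ℳ s∈)
  ... | _ , _ , ()

  pvarFree-Φᵐ : ∀ M → PvarFree (Φᵐ M)
  pvarFree-Φᵐ (def ps F) = pvarFree-SM ps F
  pvarFree-Φᵐ (prog Π)   = pvarFree-Φ Π

  pvarFree-Theory : ∀ Γ → PvarFree (Theory Γ)
  pvarFree-Theory = pvarFree-⋀ pvarFree-embed

  pvarFree-⇿ : ∀ {n} {φ ψ : SOFormula n} → PvarFree φ → PvarFree ψ → PvarFree (φ ⇿ ψ)
  pvarFree-⇿ {φ = φ} {ψ} ∉φ ∉ψ = pvarFree-bin and {φ ⊃ ψ} {ψ ⊃ φ}
    (pvarFree-bin imp {φ} {ψ} ∉φ ∉ψ) (pvarFree-bin imp {ψ} {φ} ∉ψ ∉φ)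

  -- Equality of modules and occurrences

  mutual
    ≈-refl : ∀ M → M ≈ M
    ≈-refl (def ps F)       = def
    ≈-refl (prog ⟨ S , ℳ ⟩) = prog (id , id) (⊆≈ ℳ id) (⊇≈ ℳ id)

    -- The traversed list `ℳ` is kept apart from the searched list `𝒩`, so that the induction goes
    -- through.
    ⊆≈ : ∀ ℳ {𝒩} → (∀ {M} → M ∈ᵐ ℳ → M ∈ᵐ 𝒩) → All (λ M → Any (M ≈_) 𝒩) ℳ
    ⊆≈ []      _ = []
    ⊆≈ (M ∷ ℳ) i = lose (i (here refl)) (≈-refl M) ∷ ⊆≈ ℳ (i ∘ there)

    ⊇≈ : ∀ ℳ {𝒩} → (∀ {M} → M ∈ᵐ ℳ → M ∈ᵐ 𝒩) → All (λ M → Any (_≈ M) 𝒩) ℳ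
    ⊇≈ []      _ = []
    ⊇≈ (M ∷ ℳ) i = lose (i (here refl)) (≈-refl M) ∷ ⊇≈ ℳ (i ∘ there)

  mutual
    ≈-sym : ∀ {M N} → M ≈ N → N ≈ M
    ≈-sym def                = def
    ≈-sym (prog S≋T ℳ≤𝒩 𝒩≤ℳ) = prog (swap S≋T) (symʳ 𝒩≤ℳ) (symˡ ℳ≤𝒩)

    symʳ : ∀ {ℳ 𝒩} → All (λ N → Any (_≈ N) ℳ) 𝒩 → All (λ N → Any (N ≈_) ℳ) 𝒩
    symʳ []       = []
    symʳ (i ∷ is) = symʳ₁ i ∷ symʳ is

    symʳ₁ : ∀ {ℳ N} → Any (_≈ N) ℳ → Any (N ≈_) ℳ
    symʳ₁ (here e)  = here (≈-sym e)
    symʳ₁ (there i) = there (symʳ₁ i)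

    symˡ : ∀ {ℳ 𝒩} → All (λ M → Any (M ≈_) 𝒩) ℳ → All (λ M → Any (_≈ M) 𝒩) ℳ
    symˡ []       = []
    symˡ (i ∷ is) = symˡ₁ i ∷ symˡ is

    symˡ₁ : ∀ {𝒩 M} → Any (M ≈_) 𝒩 → Any (_≈ M) 𝒩
    symˡ₁ (here e)  = here (≈-sym e)
    symˡ₁ (there i) = there (symˡ₁ i)

  -- Nesting depth of modules

  mutual
    -- A maximum ignores order and repetition in the module lists, so equal modules have equal
    -- depth.
    depth : Module → ℕ
    depth (def _ _)        = 0
    depth (prog ⟨ _ , ℳ ⟩) = suc (depths ℳ)

    depths : List Module → ℕ
    depths []      = 0
    depths (M ∷ ℳ) = depth M ⊔ depths ℳ

  mutual
    depth-≈ : ∀ {M N} → M ≈ N → depth N ≤ depth M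
    depth-≈ def            = z≤n
    depth-≈ (prog _ _ 𝒩≤ℳ) = s≤s (depths-≈ 𝒩≤ℳ)

    depths-≈ : ∀ {ℳ 𝒩} → All (λ N → Any (_≈ N) ℳ) 𝒩 → depths 𝒩 ≤ depths ℳ
    depths-≈ []       = z≤n
    depths-≈ (i ∷ is) = ⊔-lub (depth-Any i) (depths-≈ is)

    depth-Any : ∀ {ℳ N} → Any (_≈ N) ℳ → depth N ≤ depths ℳ
    depth-Any (here e)  = ≤-trans (depth-≈ e) (m≤m⊔n _ _)
    depth-Any (there i) = ≤-trans (depth-Any i) (m≤n⊔m _ _)

  mutual
    depth-occursIn : ∀ {Π M} → Π occursIn M → depth (prog Π) ≤ depth M
    depth-occursIn (here e)  = depth-≈ e
    depth-occursIn (there i) = ≤-trans (depth-occursAny i) (n≤1+n _)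

    depth-occursAny : ∀ {Π ℳ} → Any (Π occursIn_) ℳ → depth (prog Π) ≤ depths ℳ
    depth-occursAny (here o)  = ≤-trans (depth-occursIn o) (m≤m⊔n _ _)
    depth-occursAny (there i) = ≤-trans (depth-occursAny i) (m≤n⊔m _ _)

  depth-∈ : ∀ {M ℳ} → M ∈ᵐ ℳ → depth M ≤ depths ℳ
  depth-∈ (here refl) = m≤m⊔n _ _
  depth-∈ (there i)   = ≤-trans (depth-∈ i) (m≤n⊔m _ _)

  -- With `depth-modules` this shows that neither a program nor anything nested in it encloses an
  -- occurrence of that program.
  depth-⊏ : ∀ {Π Π′} → Π ⊏ Π′ → depth (prog Π) < depth (prog Π′)
  depth-⊏ (here i)    = s≤s (depth-∈ i)
  depth-⊏ (there i p) = <-trans (depth-⊏ p) (s≤s (depth-∈ i))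

  depth-modules : ∀ {Π} Π′ → Any (Π occursIn_) (modules Π′) → depth (prog Π) < depth (prog Π′)
  depth-modules ⟨ _ , _ ⟩ i = s≤s (depth-occursAny i)

  -- Replacement

  replace-≈ : ∀ {Π₁ Π₂} Π → prog Π ≈ prog Π₁ → replace Π₁ Π₂ (prog Π) ≡ prog Π₂
  replace-≈ {Π₁} Π e with prog Π ≈? prog Π₁
  ... | yes _  = refl
  ... | no ¬e = ⊥-elim (¬e e)

  mutual
    replace-id : ∀ {Π₁ Π₂} M → ¬ Π₁ occursIn M → replace Π₁ Π₂ M ≡ M
    replace-id (def _ _) _ = refl
    replace-id {Π₁} (prog ⟨ S , ℳ ⟩) ¬o with prog ⟨ S , ℳ ⟩ ≈? prog Π₁
    ... | yes e = ⊥-elim (¬o (here e))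
    ... | no _  = cong (λ 𝒩 → prog ⟨ S , 𝒩 ⟩) (replaceAll-id ℳ (¬o ∘ there))

    replaceAll-id : ∀ {Π₁ Π₂} ℳ → ¬ Any (Π₁ occursIn_) ℳ → replaceAll Π₁ Π₂ ℳ ≡ ℳ
    replaceAll-id []      _  = refl
    replaceAll-id (M ∷ ℳ) ¬o =
      cong₂ _∷_ (replace-id M (¬o ∘ here)) (replaceAll-id ℳ (¬o ∘ there))

  replaceAll-formulas : ∀ {Π₁ Π₂} Γ → replaceAll Π₁ Π₂ (map formula Γ) ≡ map formula Γ
  replaceAll-formulas []      = refl
  replaceAll-formulas (F ∷ Γ) = cong (formula F ∷_) (replaceAll-formulas Γ)

  -- Satisfaction

  module _ {Dom : Set} {fun : (f : Fn) → Vec Dom (fnArity f) → Dom} where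
    open Satisfaction Dom fun

    valuation : ((p : Pd) → Vec Dom (pdArity p) → Set) → Valuation
    valuation P (psym p) = P p
    valuation P (pvar p) = λ _ → ⊥

    override : List Sym → Valuation → Valuation → Valuation
    override h W V s with s ∈? h
    ... | yes _ = W s
    ... | no  _ = V s

    override-∉ : ∀ h {W V} s → s ∉ h → override h W V s ≡ V s
    override-∉ h s s∉h with s ∈? h
    ... | yes s∈h = ⊥-elim (s∉h s∈h)
    ... | no _    = refl

    mutual
      coincidence : ∀ {n} (φ : SOFormula n) {V W e} →
                    (∀ {s} → s ∈ free φ → V s ≡ W s) → Sat V e φ → Sat W e φ
      coincidence (atom (_ ≐ _)) eq v = v
      coincidence (atom (rel s ts)) {e = e} eq v =
        lift (subst (λ P → P (evals e ts)) (eq (here refl)) (lower v))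
      coincidence (bin and φ ψ) eq (v , w) =
        coincidence φ (eq ∘ ∈-++⁺ˡ) v , coincidence ψ (eq ∘ ∈-++⁺ʳ (free φ)) w
      coincidence (bin or φ ψ) eq (inj₁ v) = inj₁ (coincidence φ (eq ∘ ∈-++⁺ˡ) v)
      coincidence (bin or φ ψ) eq (inj₂ v) = inj₂ (coincidence ψ (eq ∘ ∈-++⁺ʳ (free φ)) v)
      coincidence (bin imp φ ψ) eq v u =
        coincidence ψ (eq ∘ ∈-++⁺ʳ (free φ)) (v (coincidence φ (sym ∘ eq ∘ ∈-++⁺ˡ) u))
      coincidence (quant univ φ) eq v d = coincidence φ eq (v d)
      coincidence (quant exis φ) eq (d , v) = d , coincidence φ eq v
      coincidence (∃² h φ) eq (U , U≡V , u) = ∃²-intro h φ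
        (λ {s} s∈ s∉h → trans (U≡V s s∉h)
                              (eq (∈-filter⁺ (λ s → ¬? (s ∈? h)) s∈ s∉h))) u

      -- `Sat` asks the witness to agree with `V` on all symbols outside `h`, not only on the free
      -- ones; `override` corrects `W` without changing any value on which `φ` depends.
      ∃²-intro : ∀ {n} h (φ : SOFormula n) {V W e} →
                 (∀ {s} → s ∈ free φ → s ∉ h → W s ≡ V s) → Sat W e φ → Sat V e (∃² h φ)
      ∃²-intro h φ {V} {W} eq w =
        override h W V , override-∉ h , coincidence φ agree w
        where
        agree : ∀ {s} → s ∈ free φ → W s ≡ override h W V s
        agree {s} s∈ with s ∈? h
        ... | yes _  = refl
        ... | no s∉h = eq s∈ s∉h

    ⊨⇔Sat : ∀ {V} (φ : SOFormula 0) → PvarFree φ →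
            record { Dom = Dom ; fun = fun ; pred = V ∘ psym } ⊨ φ ⇔ Sat V [] φ
    ⊨⇔Sat {V} φ ∉φ = mk⇔
      (coincidence φ λ { {psym _} _ → refl ; {pvar _} s∈ → ⊥-elim (∉φ s∈) })
      (coincidence φ λ { {psym _} _ → refl ; {pvar _} s∈ → ⊥-elim (∉φ s∈) })

    Sats : Valuation → List Module → Set₁
    Sats V = All (λ M → Sat V [] (Φᵐ M))

    Sat-Φs : ∀ {V} ℳ → Sat V [] (⋀ (Φs ℳ)) ⇔ Sats V ℳ
    Sat-Φs ℳ = mk⇔ (fw ℳ) bw
      where
      fw : ∀ {V} ℳ → Sat V [] (⋀ (Φs ℳ)) → Sats V ℳ
      fw []      _        = []
      fw (M ∷ ℳ) (v , vs) = v ∷ fw ℳ vs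

      bw : ∀ {V ℳ} → Sats V ℳ → Sat V [] (⋀ (Φs ℳ))
      bw []       = id
      bw (v ∷ vs) = v , bw vs

    -- The witness for the first program serves the second: a free symbol of `𝒩` that the second
    -- does not hide lies in `T`, hence in `S`, so the first does not hide it either and `W` agrees
    -- with `V` there. The step from `ℳ` to `𝒩` may use this agreement, which lets `Γ` be carried
    -- under the quantifier.
    Φ-mono : ∀ {V S T ℳ 𝒩} → T ⊆ S →
             (∀ {W} → (∀ s → s ∉ hidden ⟨ S , ℳ ⟩ → W s ≡ V s) → Sats W ℳ → Sats W 𝒩) →
             Sat V [] (Φ ⟨ S , ℳ ⟩) → Sat V [] (Φ ⟨ T , 𝒩 ⟩)
    Φ-mono {V} {S} {T} {ℳ} {𝒩} T⊆S step (W , W≡V , w) =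
      ∃²-intro (hidden ⟨ T , 𝒩 ⟩) (⋀ (Φs 𝒩))
        (λ {s} s∈ s∉h → W≡V s λ s∈h →
          hidden⁻ S ℳ s∈h (⊆public (∉hidden⇒public T 𝒩 s∈ s∉h)))
        (from (Sat-Φs 𝒩) (step W≡V (to (Sat-Φs ℳ) w)))
      where
      ⊆public : ∀ {s} → s ∈ map psym T → s ∈ map psym S
      ⊆public s∈ with ∈-map⁻ psym s∈
      ... | _ , p∈ , refl = ∈-map⁺ psym (T⊆S p∈)

    mutual
      Sat-≈ : ∀ {V M N} → M ≈ N → Sat V [] (Φᵐ M) → Sat V [] (Φᵐ N)
      Sat-≈ def = id
      Sat-≈ (prog (_ , T⊆S) _ 𝒩≤ℳ) = Φ-mono T⊆S (λ _ → Sats-≈ 𝒩≤ℳ)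

      Sats-≈ : ∀ {V ℳ 𝒩} → All (λ N → Any (_≈ N) ℳ) 𝒩 → Sats V ℳ → Sats V 𝒩
      Sats-≈ []       _  = []
      Sats-≈ (i ∷ is) vs = Sat-Any-≈ i vs ∷ Sats-≈ is vs

      Sat-Any-≈ : ∀ {V ℳ N} → Any (_≈ N) ℳ → Sats V ℳ → Sat V [] (Φᵐ N)
      Sat-Any-≈ (here e)  (v ∷ _)  = Sat-≈ e v
      Sat-Any-≈ (there i) (_ ∷ vs) = Sat-Any-≈ i vs

    Sats-formulas : ∀ {V} Γ → Sat V [] (Theory Γ) → Sats V (map formula Γ)
    Sats-formulas []      _        = []
    Sats-formulas (F ∷ Γ) (v , vs) =
      -- For the empty list `U<` reads ⊤ ∧ ¬⊤, so the quantifier in `SM` has no witness.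
      (v , λ { (_ , _ , (⊤-holds , ¬⊤-holds) , _) → ¬⊤-holds ⊤-holds }) ∷ Sats-formulas Γ vs

    -- A def-module contains no program, so the filter keeps all of `Γ` by computation.
    formulas-Sat : ∀ {V Π} Γ →
      Sat V [] (⋀ (map Φᵐ (filter (λ M → ¬? (occurs? Π M)) (map formula Γ)))) →
      Sat V [] (Theory Γ)
    formulas-Sat []      _              = id
    formulas-Sat (F ∷ Γ) ((v , _) , vs) = v , formulas-Sat Γ vs

    -- Asking for truth only where `Π₁` does not occur lets this serve both the program and its
    -- replacement.
    Sat-Φ[-] : ∀ {V} S ℳ {Π₁} → All (λ M → ¬ Π₁ occursIn M → Sat V [] (Φᵐ M)) ℳ →
               Sat V [] (Φ[ ⟨ S , ℳ ⟩ - Π₁ ])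
    Sat-Φ[-] S []           []       = id
    Sat-Φ[-] S (M ∷ ℳ) {Π₁} (v ∷ vs) with occurs? Π₁ M
    ... | yes _ = Sat-Φ[-] S ℳ vs
    ... | no ¬o = v ¬o , Sat-Φ[-] S ℳ vs

    -- Exchanging the occurrences of one program for another

    module _ (Γ : List Sentence) (Π₁ Π₂ : Program)
             (equiv : ∀ {V} → Sat V [] (Theory Γ) → Sat V [] (Φ Π₁) ⇔ Sat V [] (Φ Π₂)) where

      -- No-capture enters here: the witness changes hidden symbols only, and none of them is free
      -- in `Γ`.
      Sat-Γ-unhidden : ∀ {h V W} → (∀ s → s ∈ free (Theory Γ) → s ∉ h) →
                       (∀ s → s ∉ h → W s ≡ V s) → Sat V [] (Theory Γ) → Sat W [] (Theory Γ)
      Sat-Γ-unhidden ∉h W≡V =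
        coincidence (Theory Γ) (λ {s} s∈ → sym (W≡V s (∉h s s∈)))

      mutual
        Sat-replace : ∀ {V S ℳ} M → M ∈ᵐ ℳ → NoCapture Γ Π₁ Π₂ ⟨ S , ℳ ⟩ →
                      Sat V [] (Theory Γ) →
                      Sat V [] (Φᵐ M) ⇔ Sat V [] (Φᵐ (replace Π₁ Π₂ M))
        Sat-replace (def _ _) _ _ _ = mk⇔ id id
        Sat-replace (prog ⟨ T , 𝒩 ⟩) M∈ nc γ with prog ⟨ T , 𝒩 ⟩ ≈? prog Π₁
        ... | yes e = mk⇔ (to (equiv γ) ∘ Sat-≈ e) (Sat-≈ (≈-sym e) ∘ from (equiv γ))
        -- No-capture says nothing about a program without an occurrence; there the replacement is
        -- the identity.
        ... | no  _ with occursAny? Π₁ 𝒩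
        ...   | no ¬o rewrite replaceAll-id {Π₁} {Π₂} 𝒩 ¬o = mk⇔ id id
        ...   | yes o = mk⇔
          -- Forwards, the new valuation varies the hidden symbols of the original program;
          -- backwards, those of the replaced one. Hence the two halves of no-capture.
          (Φ-mono id λ W≡V → to (Sats-replaceAll 𝒩 id nc′
            (Sat-Γ-unhidden (λ s → proj₁ ∘ nc _ (here M∈) o s) W≡V γ)))
          (Φ-mono id λ W≡V → from (Sats-replaceAll 𝒩 id nc′
            (Sat-Γ-unhidden (λ s → proj₂ ∘ nc _ (here M∈) o s) W≡V γ)))
          where
          nc′ : NoCapture Γ Π₁ Π₂ ⟨ T , 𝒩 ⟩
          nc′ Π′ = nc Π′ ∘ there M∈

        -- `ℳ` stays the full module list, for which no-capture is stated, while `𝒩` shrinks in the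
        -- induction.
        Sats-replaceAll : ∀ {V S ℳ} 𝒩 → (∀ {M} → M ∈ᵐ 𝒩 → M ∈ᵐ ℳ) →
                          NoCapture Γ Π₁ Π₂ ⟨ S , ℳ ⟩ → Sat V [] (Theory Γ) →
                          Sats V 𝒩 ⇔ Sats V (replaceAll Π₁ Π₂ 𝒩)
        Sats-replaceAll []      _   _  _ = mk⇔ (λ _ → []) (λ _ → [])
        Sats-replaceAll (N ∷ 𝒩) 𝒩⊆ℳ nc γ = mk⇔
          (λ { (v ∷ vs) → to   head v ∷ to   tail vs })
          (λ { (v ∷ vs) → from head v ∷ from tail vs })
          where
          head = Sat-replace N (𝒩⊆ℳ (here refl)) nc γ
          tail = Sats-replaceAll 𝒩 (𝒩⊆ℳ ∘ there) nc γ

      -- Replacement fixes the modules without an occurrence, so `Γ` can be derived from the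
      -- replaced program as well.
      survivors-replaceAll : ∀ {V} ℳ → Sats V (replaceAll Π₁ Π₂ ℳ) →
                             All (λ M → ¬ Π₁ occursIn M → Sat V [] (Φᵐ M)) ℳ
      survivors-replaceAll []      []       = []
      survivors-replaceAll {V} (M ∷ ℳ) (v ∷ vs) =
        (λ ¬o → subst (λ N → Sat V [] (Φᵐ N)) (replace-id M ¬o) v) ∷ survivors-replaceAll ℳ vs

      -- `Γ` is derived afresh for each choice of the hidden symbols instead of being carried under
      -- the quantifier, so hidden symbols of `Π` itself may be free in `Γ`.
      Sat-Φ-replace : ∀ {V} Π → NoCapture Γ Π₁ Π₂ Π →
                      (∀ {W} → Sat W [] (Φ[ Π - Π₁ ]) → Sat W [] (Theory Γ)) →
                      Sat V [] (Φ Π) ⇔ Sat V [] (Φ (Π [ Π₁ / Π₂ ]))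
      Sat-Φ-replace ⟨ S , ℳ ⟩ nc context = mk⇔
        (Φ-mono id λ _ w → to (Sats-replaceAll ℳ id nc
          (context (Sat-Φ[-] S ℳ (All.map (λ v _ → v) w)))) w)
        (Φ-mono id λ _ w → from (Sats-replaceAll ℳ id nc
          (context (Sat-Φ[-] S ℳ (survivors-replaceAll ℳ w)))) w)

  -- Strong equivalence

  EquivalentUnder : List Sentence → Program → Program → Set₁
  EquivalentUnder Γ Π₁ Π₂ =
    (H : Herbrand) → herbrand H ⊨ Theory Γ → herbrand H ⊨ (Φ Π₁ ⇿ Φ Π₂)

  open Satisfaction (Term 0) fn

  -- Below a quantifier the valuation is arbitrary; where no predicate variable is free it amounts
  -- to a Herbrand interpretation, to which the hypothesis applies.
  Sat-⇿ : ∀ {Γ Π₁ Π₂} → EquivalentUnder Γ Π₁ Π₂ →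
          ∀ {V} → Sat V [] (Theory Γ) → Sat V [] (Φ Π₁) ⇔ Sat V [] (Φ Π₂)
  Sat-⇿ {Γ} {Π₁} {Π₂} equiv {V} γ =
    let v₁₂ , v₂₁ = to (⊨⇔Sat (Φ Π₁ ⇿ Φ Π₂) (pvarFree-⇿ {φ = Φ Π₁} {Φ Π₂} (pvarFree-Φ Π₁) (pvarFree-Φ Π₂)))
                       (equiv (V ∘ psym) (from (⊨⇔Sat (Theory Γ) (pvarFree-Theory Γ)) γ))
    in mk⇔ v₁₂ v₂₁

  equivalent⇒strong : ∀ {Γ Π₁ Π₂} → EquivalentUnder Γ Π₁ Π₂ → StronglyEquivalent Γ Π₁ Π₂
  equivalent⇒strong {Γ} {Π₁} {Π₂} equiv Π@(⟨ S , ℳ ⟩) nc context H = mk⇔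
    -- Replacement leaves the public predicates unchanged, so `over` carries across.
    (λ { (over , v) → over , from sat′ (to   step (to sat  v)) })
    (λ { (over , v) → over , from sat  (from step (to sat′ v)) })
    where
    sat  = ⊨⇔Sat {V = valuation {fun = fn} H} (Φ Π) (pvarFree-Φ Π)
    sat′ = ⊨⇔Sat {V = valuation {fun = fn} H} (Φ (Π [ Π₁ / Π₂ ])) (pvarFree-Φ (Π [ Π₁ / Π₂ ]))
    rest = filter (λ M → ¬? (occurs? Π₁ M)) ℳ
    step = Sat-Φ-replace Γ Π₁ Π₂ (Sat-⇿ equiv) Π nc λ w →
      to (⊨⇔Sat (Theory Γ) (pvarFree-Theory Γ))
         (context _ (from (⊨⇔Sat (Φ[ Π - Π₁ ]) (pvarFree-⋀ pvarFree-Φᵐ rest)) w))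

  -- The test program

  symbol : Sym → Pd
  symbol (psym p) = p
  -- A default value: no predicate variable is free in `relevant`.
  symbol (pvar p) = p

  module _ {Γ : List Sentence} {Π₁ Π₂ : Program} (strong : StronglyEquivalent Γ Π₁ Π₂) where

    relevant : SOFormula 0
    relevant = Theory Γ ∧' (Φ Π₁ ⇿ Φ Π₂)

    -- Public predicates form a finite list, while `Pd` may be infinite; those free in `relevant`
    -- determine the truth values compared.
    S : List Pd
    S = map symbol (free relevant)

    test : Program → Program
    test Π = ⟨ S , prog Π ∷ map formula Γ ⟩

    no-subprogram-of-formulas : ∀ {Π} Δ → ¬ prog Π ∈ᵐ map formula Δ
    no-subprogram-of-formulas (_ ∷ Δ) (there i) = no-subprogram-of-formulas Δ i

    test-replace : test Π₁ [ Π₁ / Π₂ ] ≡ test Π₂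
    test-replace = cong₂ (λ N 𝒩 → ⟨ S , N ∷ 𝒩 ⟩)
      (replace-≈ Π₁ (≈-refl (prog Π₁))) (replaceAll-formulas Γ)

    test-noCapture : NoCapture Γ Π₁ Π₂ (test Π₁)
    test-noCapture Π′ (here (here refl)) o =
      ⊥-elim (<-irrefl refl (depth-modules Π₁ o))
    test-noCapture Π′ (there (here refl) p) o =
      ⊥-elim (<-irrefl refl (<-trans (depth-modules Π′ o) (depth-⊏ p)))
    test-noCapture Π′ (here (there i)) _ = ⊥-elim (no-subprogram-of-formulas Γ i)
    test-noCapture Π′ (there (there i) _) _ = ⊥-elim (no-subprogram-of-formulas Γ i)

    test-context : Φ[ test Π₁ - Π₁ ] ⊫ Theory Γ
    test-context I v = from (⊨⇔Sat (Theory Γ) (pvarFree-Theory Γ)) (drop-Π₁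
      (to (⊨⇔Sat {V = V} (Φ[ test Π₁ - Π₁ ]) (pvarFree-⋀ pvarFree-Φᵐ rest)) v))
      where
      open Interpretation I
      module Sᴵ = Satisfaction Dom fun
      V = valuation {Dom} {fun} pred
      rest = filter (λ M → ¬? (occurs? Π₁ M)) (modules (test Π₁))
      drop-Π₁ : Sᴵ.Sat V [] (Φ[ test Π₁ - Π₁ ]) → Sᴵ.Sat V [] (Theory Γ)
      -- `Π₁` occurs in itself, so the filter removes it; the other branch, which cannot arise,
      -- drops its conjunct.
      drop-Π₁ w with occurs? Π₁ (prog Π₁)
      ... | yes _ = formulas-Sat Γ w
      ... | no _  = formulas-Sat Γ (proj₂ w)

    test-intro : ∀ {V} Π → Sat V [] (Theory Γ) → Sat V [] (Φ Π) → Sat V [] (Φ (test Π))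
    test-intro {V} Π γ v =
      V , (λ _ _ → refl) , from (Sat-Φs (modules (test Π))) (v ∷ Sats-formulas Γ γ)

    -- Symbols free in `Φ Π` are public in `test Π`, so the witness for the hidden symbols cannot
    -- alter them.
    test-elim : ∀ {V} Π → (∀ {s} → s ∈ free (Φ Π) → s ∈ free relevant) →
                Sat V [] (Φ (test Π)) → Sat V [] (Φ Π)
    test-elim {V} Π incl (W , W≡V , w , _) = coincidence (Φ Π) unhidden w
      where
      unhidden : ∀ {s} → s ∈ free (Φ Π) → W s ≡ V s
      unhidden {pvar p} s∈ = ⊥-elim (pvarFree-Φ Π s∈)
      unhidden {psym p} s∈ = W≡V (psym p) λ s∈h →
        hidden⁻ S (modules (test Π)) s∈h (∈-map⁺ psym (∈-map⁺ symbol (incl s∈)))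

    -- An answer set of a test program is empty outside `S`, which an arbitrary `H` need not be;
    -- `relevant` cannot tell the two apart.
    restrict : Herbrand → Herbrand
    restrict H p with p ∈ᵖ? S
    ... | yes _ = H p
    ... | no  _ = λ _ → ⊥

    restrict-over : ∀ H → Over S (restrict H)
    restrict-over H p p∉ ts h with p ∈ᵖ? S
    ... | yes p∈ = p∉ p∈
    ... | no _   = h

    restrict-agree : ∀ H {s} → s ∈ free relevant →
                     valuation {fun = fn} H s ≡ valuation {fun = fn} (restrict H) s
    restrict-agree H {pvar p} _ = refl
    restrict-agree H {psym p} s∈ with p ∈ᵖ? S
    ... | yes _  = refl
    ... | no p∉ = ⊥-elim (p∉ (∈-map⁺ symbol s∈))

    strong⇒equivalent : EquivalentUnder Γ Π₁ Π₂
    strong⇒equivalent H h =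
      from (⊨⇔Sat (Φ Π₁ ⇿ Φ Π₂) (pvarFree-⇿ {φ = Φ Π₁} {Φ Π₂} (pvarFree-Φ Π₁) (pvarFree-Φ Π₂)))
        (coincidence (Φ Π₁ ⇿ Φ Π₂) (sym ∘ restrict-agree H ∘ ∈-++⁺ʳ (free (Theory Γ))) (fw , bw))
      where
      H′ = restrict H
      V = valuation {fun = fn} H′

      γ : Sat V [] (Theory Γ)
      γ = coincidence (Theory Γ) (restrict-agree H ∘ ∈-++⁺ˡ)
            (to (⊨⇔Sat {V = valuation {fun = fn} H} (Theory Γ) (pvarFree-Theory Γ)) h)

      answerSets : AnswerSet (test Π₁) H′ ⇔ AnswerSet (test Π₂) H′
      answerSets = subst (λ Π → AnswerSet (test Π₁) H′ ⇔ AnswerSet Π H′) test-replace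
        (strong (test Π₁) test-noCapture test-context H′)

      sat : ∀ Π → herbrand H′ ⊨ Φ (test Π) ⇔ Sat V [] (Φ (test Π))
      sat Π = ⊨⇔Sat (Φ (test Π)) (pvarFree-Φ (test Π))

      relevant₁ : ∀ {s} → s ∈ free (Φ Π₁) → s ∈ free relevant
      relevant₁ = ∈-++⁺ʳ (free (Theory Γ)) ∘ ∈-++⁺ˡ ∘ ∈-++⁺ˡ

      relevant₂ : ∀ {s} → s ∈ free (Φ Π₂) → s ∈ free relevant
      relevant₂ = ∈-++⁺ʳ (free (Theory Γ)) ∘ ∈-++⁺ˡ ∘ ∈-++⁺ʳ (free (Φ Π₁))

      fw : Sat V [] (Φ Π₁) → Sat V [] (Φ Π₂)
      fw v = test-elim Π₂ relevant₂ (to (sat Π₂) (proj₂ (to answerSets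
        (restrict-over H , from (sat Π₁) (test-intro Π₁ γ v)))))

      bw : Sat V [] (Φ Π₂) → Sat V [] (Φ Π₁)
      bw v = test-elim Π₁ relevant₁ (to (sat Π₁) (proj₂ (from answerSets
        (restrict-over H , from (sat Π₂) (test-intro Π₂ γ v)))))

theorem2 : (σ : Signature) → let open Language σ in
    (Γ : List Sentence) (Π Π′ : Program) →
    StronglyEquivalent Γ Π Π′ ⇔
    ((H : Herbrand) → herbrand H ⊨ Theory Γ → herbrand H ⊨ (Φ Π ⇿ Φ Π′))
theorem2 σ Γ Π Π′ = mk⇔ strong⇒equivalent equivalent⇒strong
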